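{- For every integer $n\ge 3$, the threshold bias of the $(1:q)$ Budget Triangle Game on $K_n$ is exactly $$q_\triangle^b(n)=\left\lceil\sqrt{2n-2}-\frac{3}{2}\right\rceil .$$
   Context: For an integer $n\ge 3$ and a non-negative integer $q$ (the bias), the $(1:q)$ Budget Triangle Game on the complete graph $K_n$ is played by two players, Maker and Breaker, who take alternate turns, with Maker beginning. In her turn, Maker claims one previously unclaimed edge of $K_n$. In his turn, Breaker may claim an arbitrary number (possibly zero) of previously unclaimed edges of $K_n$, subject to the condition that at the end of his turn the total number of edges claimed by Breaker so far is at most $q$ times the total number of edges claimed by Maker so far. Maker wins if at some point she has claimed all three edges of a triangle of $K_n$. Breaker wins if he manages to claim at least one edge of each triangle of $K_n$. The threshold bias $q_\triangle^b(n)$ is the smallest non-negative integer $q$ such that Breaker has a winning strategy in this game. -}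

module Defs where

open import Data.Nat.Base using (ℕ; _≤_; _*_)
open import Data.Fin.Base using (Fin; _<_)
open import Data.Fin.Properties using (<-trans)
open import Data.Integer.Base as ℤ using (ℤ; +_)
open import Data.List.Base using (List; []; _∷_; _++_; length; map; concatMap)
open import Data.List.Membership.Propositional using (_∈_; _∉_)
open import Data.List.Relation.Unary.All using (All)
open import Data.List.Relation.Unary.Unique.Propositional using (Unique)
open import Data.Product.Base using (Σ-syntax; _×_; _,_; proj₁; proj₂)
open import Data.Rational.Unnormalised.Base as ℚᵘ using (ℚᵘ; 0ℚᵘ; _/_)
open import Data.Sum.Base using (_⊎_)
open import Relation.Nullary.Negation.Core using (¬_)

-- The edge {lo, hi} of Kₙ.  The ordering proof is irrelevant, so an edge is
-- determined by its endpoints.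
record Edge (n : ℕ) : Set where
  constructor edge
  field
    lo hi  : Fin n
    .lo<hi : lo < hi

-- Maker's edge, followed by the edges Breaker claims in reply.
Round : ℕ → Set
Round n = Edge n × List (Edge n)

-- Completed rounds, most recent first.
History : ℕ → Set
History n = List (Round n)

makerEdges : ∀ {n} → History n → List (Edge n)
makerEdges = map proj₁

breakerEdges : ∀ {n} → History n → List (Edge n)
breakerEdges = concatMap proj₂

Claimed : ∀ {n} → History n → Edge n → Set
Claimed h e = e ∈ makerEdges h ⊎ e ∈ breakerEdges h

Unclaimed : ∀ {n} → History n → Edge n → Set
Unclaimed h e = ¬ Claimed h e

-- Whether Breaker may reply with the edges bs after Maker has claimed e in the
-- position h.  Edges are never claimed twice, so the lengths in the budget
-- condition are the numbers of edges claimed.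
record LegalReply {n} (q : ℕ) (h : History n) (e : Edge n) (bs : List (Edge n)) : Set where
  field
    distinct  : Unique bs
    unclaimed : All (Unclaimed h) bs
    not-e     : e ∉ bs
    budget    : length (breakerEdges ((e , bs) ∷ h)) ≤ q * length (makerEdges ((e , bs) ∷ h))

BreakerStrategy : ℕ → Set
BreakerStrategy n = History n → Edge n → List (Edge n)

-- The histories that can arise when Breaker follows σ.
data PlayedBy {n} (σ : BreakerStrategy n) : History n → Set where
  start : PlayedBy σ []
  round : ∀ {h e} → PlayedBy σ h → Unclaimed h e → PlayedBy σ ((e , σ h e) ∷ h)

HitsEveryTriangle : ∀ {n} → List (Edge n) → Set
HitsEveryTriangle {n} B =
  ∀ (i j k : Fin n) (i<j : i < j) (j<k : j < k) →
  edge i j i<j ∈ B ⊎ edge j k j<k ∈ B ⊎ edge i k (<-trans i<j j<k) ∈ B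

-- Play goes on until every edge is claimed.  This loses nothing: Breaker may
-- always claim no edge, and since claimed edges are kept, once he has an edge of
-- every triangle he still has one at the end, whereas once Maker owns a triangle
-- he never will.
record Winning {n} (q : ℕ) (σ : BreakerStrategy n) : Set where
  field
    legal : ∀ {h e} → PlayedBy σ h → Unclaimed h e → LegalReply q h e (σ h e)
    wins  : ∀ {h} → PlayedBy σ h → (∀ e → Claimed h e) → HitsEveryTriangle (breakerEdges h)

BreakerHasWinningStrategy : (n q : ℕ) → Set
BreakerHasWinningStrategy n q = Σ[ σ ∈ BreakerStrategy n ] Winning q σ

IsThresholdBias : (n q : ℕ) → Set
IsThresholdBias n q =
  BreakerHasWinningStrategy n q × (∀ q′ → BreakerHasWinningStrategy n q′ → q ≤ q′)

-- A real number x is represented by its open lower Dedekind cut: the predicate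
-- r < x on rationals r.
Cut : Set₁
Cut = ℚᵘ → Set

infix 4 _<ᶜ_
_<ᶜ_ : ℚᵘ → Cut → Set
r <ᶜ x = x r

-- The non-negative square root of a rational a ≥ 0.
√ : ℚᵘ → Cut
√ a r = r ℚᵘ.< 0ℚᵘ ⊎ r ℚᵘ.* r ℚᵘ.< a

infixl 6 _-ᶜ_
_-ᶜ_ : Cut → ℚᵘ → Cut
(x -ᶜ s) r = (r ℚᵘ.+ s) <ᶜ x

-- k = ⌈x⌉, that is, k - 1 < x ≤ k.
IsCeiling : Cut → ℤ → Set
IsCeiling x k = ((k ℤ.- + 1) / 1) <ᶜ x × ¬ ((k / 1) <ᶜ x)

{-# OPTIONS --safe #-}

-- Both directions meet at 2 (n − 1) ≤ (q + 1) (q + 2), which is the ceiling formula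
-- with the square root cleared.
--
-- Breaker, when this holds: claim every free edge that has an end of Maker degree
-- at least q + 1 or whose ends have a common Maker neighbour.  Then Maker never gets
-- a triangle nor a degree above q + 1.  Let F be the set of vertices of Maker degree
-- q + 1, and let t(u) be the number of Maker neighbours of u in F.  A vertex of F has
-- at most n − 1 − (q + 1) ≤ q (q + 1) / 2 Breaker edges, and each Breaker edge avoiding
-- F joins two neighbours of some u.  So Breaker has at most
--   Σ_{x ∈ F} q (q + 1) / 2 + Σ_u C(d(u) − t(u), 2) ≤ Σ_u q d(u) / 2
-- edges, because Σ_{x ∈ F} (q + 1) = Σ_u t(u) and d(u) − t(u) ≤ q + 1.
--
-- Maker, against any winning Breaker: take edges at one vertex until none is free.
-- If she gets d of them, Breaker must own all C(d, 2) edges between the leaves and the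
-- n − 1 − d other edges at the centre, so n − 1 ≤ (q + 1) d − C(d, 2) ≤ (q + 1) (q + 2) / 2.
module Submission where

open import Defs
open import Data.Nat.Base using (ℕ; zero; suc; _+_; _*_; _∸_; _≤_; _<_; z≤n; s≤s)
open import Data.Nat.Properties
open import Data.Nat.Tactic.RingSolver using (solve-∀)
open import Data.Bool.Base using (if_then_else_)
open import Data.Empty using (⊥)
open import Data.Fin.Base as Fin using (Fin; zero; suc)
import Data.Fin.Properties as Finₚ
open import Data.Integer.Base as ℤ using (ℤ)
import Data.Integer.Properties as ℤₚ
open import Data.List.Base
  using (List; []; _∷_; _++_; length; filter; concatMap; allFin; cartesianProduct; deduplicate)
open import Data.List.Membership.Propositional using (_∈_; _∉_; lose)
import Data.List.Membership.DecPropositional as DecMembership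
open import Data.List.Membership.Propositional.Properties
  using (∈-++⁺ˡ; ∈-++⁺ʳ; ∈-++⁻; ∈-filter⁺; ∈-filter⁻; ∈-concatMap⁺;
          ∈-cartesianProduct⁺; ∈-allFin; ∈-deduplicate⁺)
open import Data.List.Relation.Binary.Disjoint.Propositional using (Disjoint)
open import Data.List.Relation.Binary.Subset.Propositional using (_⊆_)
open import Data.List.Relation.Unary.All as All using (All; []; _∷_)
open import Data.List.Relation.Unary.All.Properties using (¬Any⇒All¬)
open import Data.List.Relation.Unary.AllPairs using ([]; _∷_)
open import Data.List.Relation.Unary.Any using (here; there)
open import Data.List.Relation.Unary.Unique.Propositional using (Unique)
import Data.List.Relation.Unary.Unique.Propositional.Properties as Unique
import Data.List.Relation.Unary.Unique.DecPropositional.Properties as DecUnique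
open import Data.Product.Base as Product using (∃-syntax; _×_; _,_; proj₁; proj₂)
open import Data.Rational.Unnormalised.Base using (_/_; *<*)
open import Data.Sum.Base as Sum using (_⊎_; inj₁; inj₂; [_,_]′)
open import Function.Base using (_∘_; id)
open import Function.Bundles using (_⇔_; mk⇔; Equivalence)
open import Relation.Binary.Definitions using (DecidableEquality; tri<; tri≈; tri>)
open import Relation.Binary.PropositionalEquality
open import Relation.Nullary
open import Relation.Nullary.Decidable using (map′)
open import Algebra.Properties.Semiring.Sum +-*-semiring

open Edge

private variable n : ℕ

-- Sums and indicators

sum-mono : {f g : Fin n → ℕ} → (∀ i → f i ≤ g i) → sum f ≤ sum g
sum-mono {zero}  f≤g = z≤n
sum-mono {suc n} f≤g = +-mono-≤ (f≤g zero) (sum-mono (f≤g ∘ suc))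

term≤sum : ∀ (f : Fin n → ℕ) i → f i ≤ sum f
term≤sum f zero    = m≤m+n _ _
term≤sum f (suc i) = ≤-trans (term≤sum (f ∘ suc) i) (m≤n+m _ _)

sum-const : ∀ n (c : ℕ) → sum {n} (λ _ → c) ≡ n * c
sum-const zero    c = refl
sum-const (suc n) c = cong (c +_) (sum-const n c)

∑∑ : (Fin n → Fin n → ℕ) → ℕ
∑∑ f = sum (λ x → sum (f x))

∑∑-distrib-+ : ∀ (f g : Fin n → Fin n → ℕ) → ∑∑ (λ x y → f x y + g x y) ≡ ∑∑ f + ∑∑ g
∑∑-distrib-+ f g = trans (sum-cong-≗ (λ x → ∑-distrib-+ (f x) (g x))) (∑-distrib-+ (sum ∘ f) (sum ∘ g))

sum*sum : ∀ (f g : Fin n → ℕ) → ∑∑ (λ x y → f x * g y) ≡ sum f * sum g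
sum*sum f g = trans (sum-cong-≗ (λ x → sym (*-distribˡ-sum (f x) g))) (sym (*-distribʳ-sum (sum g) f))

-- The indicator inspects only `does`, so `δ (suc x) (suc y)` reduces to `δ x y` and inductions over
-- `Fin` go through by computation.
⟦_⟧ : ∀ {p} {P : Set p} → Dec P → ℕ
⟦ d ⟧ = if does d then 1 else 0

⟦⟧-true : ∀ {p} {P : Set p} (d : Dec P) → P → ⟦ d ⟧ ≡ 1
⟦⟧-true (yes _) _ = refl
⟦⟧-true (no ¬p) p = contradiction p ¬p

⟦⟧-false : ∀ {p} {P : Set p} (d : Dec P) → ¬ P → ⟦ d ⟧ ≡ 0
⟦⟧-false (yes p) ¬p = contradiction p ¬p
⟦⟧-false (no _)  _  = refl

⟦⟧+⟦¬⟧ : ∀ {p} {P : Set p} (d : Dec P) → ⟦ d ⟧ + ⟦ ¬? d ⟧ ≡ 1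
⟦⟧+⟦¬⟧ (yes _) = refl
⟦⟧+⟦¬⟧ (no _)  = refl

⟦⟧≤1 : ∀ {p} {P : Set p} (d : Dec P) → ⟦ d ⟧ ≤ 1
⟦⟧≤1 (yes _) = s≤s z≤n
⟦⟧≤1 (no _)  = z≤n

δ : Fin n → Fin n → ℕ
δ x y = ⟦ x Finₚ.≟ y ⟧

δ-refl : ∀ (x : Fin n) → δ x x ≡ 1
δ-refl zero    = refl
δ-refl (suc x) = δ-refl x

δ-≢ : ∀ {x y : Fin n} → x ≢ y → δ x y ≡ 0
δ-≢ = ⟦⟧-false (_ Finₚ.≟ _)

sum-δ : ∀ (x : Fin n) (f : Fin n → ℕ) → sum (λ y → δ x y * f y) ≡ f x
sum-δ {suc n} zero f = trans (cong₂ _+_ (*-identityˡ _) (sum-replicate-zero n)) (+-identityʳ _)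
sum-δ (suc x) f = sum-δ x (f ∘ suc)

sum-δ-1 : ∀ (x : Fin n) → sum (δ x) ≡ 1
sum-δ-1 x = trans (sum-cong-≗ λ y → sym (*-identityʳ (δ x y))) (sum-δ x (λ _ → 1))

m≤1⇒m*m≡m : ∀ {m} → m ≤ 1 → m * m ≡ m
m≤1⇒m*m≡m z≤n       = refl
m≤1⇒m*m≡m (s≤s z≤n) = refl

-- The budget inequality, by double counting.

-- m and b are the adjacency matrices of Maker's and of Breaker's graph.
module Budget {q : ℕ} (m b : Fin n → Fin n → ℕ)
  (m-sym : ∀ x y → m x y ≡ m y x) (b-sym : ∀ x y → b x y ≡ b y x)
  (simple : ∀ x y → δ x y + (m x y + b x y) ≤ 1)
  (n-bound : 2 * n ≤ suc q * suc (suc q) + 2)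
  (degree≤ : ∀ x → sum (m x) ≤ suc q)
  (reason : ∀ x y → 1 ≤ b x y →
            suc q ≤ sum (m x) ⊎ suc q ≤ sum (m y) ⊎ ∃[ u ] (1 ≤ m u x × 1 ≤ m u y))
  where

  full? : ∀ x → Dec (suc q ≤ sum (m x))
  full? x = suc q ≤? sum (m x)

  full nonfull : Fin n → ℕ
  full    x = ⟦ full? x ⟧
  nonfull x = ⟦ ¬? (full? x) ⟧

  full+nonfull : ∀ x → full x + nonfull x ≡ 1
  full+nonfull x = ⟦⟧+⟦¬⟧ (full? x)

  -- The row sum of m′ at u is d(u) − t(u).
  m′ : Fin n → Fin n → ℕ
  m′ u x = nonfull x * m u x

  -- Common Maker neighbours, counted only when neither `x` nor `y` is in F. Summed over all ordered
  -- pairs this is Σ_u (d(u) - t(u))².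
  codegree : Fin n → Fin n → ℕ
  codegree x y = sum (λ u → m′ u x * m′ u y)

  m≤1 : ∀ x y → m x y ≤ 1
  m≤1 x y = ≤-trans (≤-trans (m≤m+n _ _) (m≤n+m _ (δ x y))) (simple x y)

  b≤1 : ∀ x y → b x y ≤ 1
  b≤1 x y = ≤-trans (≤-trans (m≤n+m _ (m x y)) (m≤n+m _ (δ x y))) (simple x y)

  nonfull≤1 : ∀ x → nonfull x ≤ 1
  nonfull≤1 x = ⟦⟧≤1 (¬? (full? x))

  m′≤m : ∀ u x → m′ u x ≤ m u x
  m′≤m u x = ≤-trans (*-monoˡ-≤ (m u x) (nonfull≤1 x)) (≤-reflexive (*-identityˡ _))

  -- The δ-term removes the pairs x = y, so that unordered pairs of neighbours are counted
  -- twice, without a subtraction.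
  pointwise : ∀ x y → b x y + δ x y * codegree x y ≤
                      (full x * b x y + full y * b x y) + codegree x y
  pointwise x y with x Finₚ.≟ y | simple x y
  -- On the diagonal `simple` forces `b x x` to vanish, and both sides contain `codegree x x`.
  ... | yes _ | s≤s mb≤0
    rewrite n≤0⇒n≡0 (≤-trans (m≤n+m (b x y) (m x y)) mb≤0) | +-identityʳ (codegree x y) = m≤n+m _ _
  ... | no x≢y | _ rewrite +-identityʳ (b x y) with 1 ≤? b x y
  ...   | no b<1 rewrite n<1⇒n≡0 (≰⇒> b<1) = z≤n
  ...   | yes 1≤b with full? x | full? y
  ...     | yes fx | _ rewrite ⟦⟧-true (full? x) fx | +-identityʳ (b x y) =
    ≤-trans (m≤m+n _ _) (m≤m+n _ _)
  ...     | no _ | yes fy rewrite ⟦⟧-true (full? y) fy | +-identityʳ (b x y) =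
    ≤-trans (m≤n+m (b x y) (full x * b x y)) (m≤m+n _ _)
  ...     | no ¬fx | no ¬fy with reason x y 1≤b
  ...       | inj₁ fx = contradiction fx ¬fx
  ...       | inj₂ (inj₁ fy) = contradiction fy ¬fy
  -- Neither end is full, so the common neighbour `u` contributes a positive term to `codegree x y`.
  ...       | inj₂ (inj₂ (u , 1≤ux , 1≤uy)) = begin
    b x y              ≤⟨ b≤1 x y ⟩
    1                  ≤⟨ *-mono-≤ (*-mono-≤ (1≤nonfull ¬fx) 1≤ux) (*-mono-≤ (1≤nonfull ¬fy) 1≤uy) ⟩
    m′ u x * m′ u y    ≤⟨ term≤sum (λ u → m′ u x * m′ u y) u ⟩
    codegree x y       ≤⟨ m≤n+m _ _ ⟩
    (full x * b x y + full y * b x y) + codegree x y ∎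
    where
    open ≤-Reasoning
    1≤nonfull : ∀ {x} → ¬ (suc q ≤ sum (m x)) → 1 ≤ nonfull x
    1≤nonfull {x} ¬fx = ≤-reflexive (sym (⟦⟧-true (¬? (full? x)) ¬fx))

  degree-m′≤ : ∀ u → sum (m′ u) ≤ suc q
  degree-m′≤ u = ≤-trans (sum-mono (m′≤m u)) (degree≤ u)

  ∑∑m′≡ : ∑∑ m′ ≡ sum (λ x → nonfull x * sum (m x))
  ∑∑m′≡ = trans (∑-comm m′) (sum-cong-≗ λ x →
    trans (sym (*-distribˡ-sum (nonfull x) (λ u → m u x)))
          (cong (nonfull x *_) (sum-cong-≗ λ u → m-sym u x)))

  -- With `u` outermost the inner double sum is a square, and one of its two factors is at most q +
  -- 1.
  ∑∑-codegree≤ : ∑∑ codegree ≤ suc q * ∑∑ m′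
  ∑∑-codegree≤ = begin
    ∑∑ codegree
      ≡⟨ sum-cong-≗ (λ x → ∑-comm (λ y u → m′ u x * m′ u y)) ⟩
    sum (λ x → sum (λ u → sum (λ y → m′ u x * m′ u y)))
      ≡⟨ ∑-comm (λ x u → sum (λ y → m′ u x * m′ u y)) ⟩
    sum (λ u → ∑∑ (λ x y → m′ u x * m′ u y))
      ≡⟨ sum-cong-≗ (λ u → sum*sum (m′ u) (m′ u)) ⟩
    sum (λ u → sum (m′ u) * sum (m′ u))
      ≤⟨ sum-mono (λ u → *-monoˡ-≤ (sum (m′ u)) (degree-m′≤ u)) ⟩
    sum (λ u → suc q * sum (m′ u))
      ≡⟨ sym (*-distribˡ-sum (suc q) (sum ∘ m′)) ⟩
    suc q * ∑∑ m′ ∎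
    where open ≤-Reasoning

  -- The entries of `m′` are 0 or 1, hence equal to their squares.
  ∑∑-diagonal : ∑∑ (λ x y → δ x y * codegree x y) ≡ ∑∑ m′
  ∑∑-diagonal = trans
    (sum-cong-≗ λ x → trans (sum-δ x (codegree x))
      (sum-cong-≗ λ u → m≤1⇒m*m≡m (≤-trans (m′≤m u x) (m≤1 u x))))
    (sym (∑-comm m′))

  -- Row `x` has n places, and `simple` lets each be taken at most once: by `x` itself, a Maker edge
  -- or a Breaker edge.
  degree-b : ∀ x → sum (m x) + sum (b x) + 1 ≤ n
  degree-b x = begin
    sum (m x) + sum (b x) + 1                   ≡⟨ rearrange (sum (m x)) _ ⟩
    1 + (sum (m x) + sum (b x))                 ≡⟨ cong₂ _+_ (sum-δ-1 x) (∑-distrib-+ (m x) (b x)) ⟨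
    sum (δ x) + sum (λ y → m x y + b x y)       ≡⟨ sym (∑-distrib-+ (δ x) _) ⟩
    sum (λ y → δ x y + (m x y + b x y))         ≤⟨ sum-mono (simple x) ⟩
    sum {n} (λ _ → 1)                           ≡⟨ trans (sum-const n 1) (*-identityʳ n) ⟩
    n                                           ∎
    where
    open ≤-Reasoning
    rearrange : ∀ a c → a + c + 1 ≡ 1 + (a + c)
    rearrange = solve-∀

  full-degree-b : ∀ x → full x * sum (b x) + full x * sum (b x) ≤ q * (full x * sum (m x))
  full-degree-b x with full? x
  ... | no ¬f rewrite ⟦⟧-false (full? x) ¬f = z≤n
  -- The constant added to both sides is twice the q + 1 Maker neighbours and the vertex itself,
  -- which replaces the subtraction in n - 1 - (q + 1).
  ... | yes f rewrite ⟦⟧-true (full? x) f | +-identityʳ (sum (b x)) | +-identityʳ (sum (m x)) =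
    +-cancelʳ-≤ (2 * suc q + 2) _ _ (begin
    β + β + (2 * suc q + 2)           ≡⟨ e₁ β q ⟩
    2 * (suc q + β + 1)               ≤⟨ *-monoʳ-≤ 2 (+-monoˡ-≤ 1 (+-monoˡ-≤ β f)) ⟩
    2 * (sum (m x) + β + 1)           ≤⟨ *-monoʳ-≤ 2 (degree-b x) ⟩
    2 * n                             ≤⟨ n-bound ⟩
    suc q * suc (suc q) + 2           ≡⟨ e₂ q ⟩
    q * suc q + (2 * suc q + 2)       ≤⟨ +-monoˡ-≤ (2 * suc q + 2) (*-monoʳ-≤ q f) ⟩
    q * sum (m x) + (2 * suc q + 2)   ∎)
    where
    open ≤-Reasoning
    β = sum (b x)
    e₁ : ∀ β q → β + β + (2 * suc q + 2) ≡ 2 * (suc q + β + 1)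
    e₁ = solve-∀
    e₂ : ∀ q → suc q * suc (suc q) + 2 ≡ q * suc q + (2 * suc q + 2)
    e₂ = solve-∀

  -- By symmetry of `b` the two summands have equal totals, so each full vertex pays twice its
  -- Breaker degree, as `full-degree-b` expects.
  ∑∑-full : ∑∑ (λ x y → full x * b x y + full y * b x y) ≤ q * sum (λ x → full x * sum (m x))
  ∑∑-full = begin
    ∑∑ (λ x y → full x * b x y + full y * b x y)
      ≡⟨ ∑∑-distrib-+ (λ x y → full x * b x y) (λ x y → full y * b x y) ⟩
    ∑∑ (λ x y → full x * b x y) + ∑∑ (λ x y → full y * b x y)
      ≡⟨ cong₂ _+_ rows (trans (∑-comm (λ x y → full y * b x y))
           (trans (sum-cong-≗ λ y → sum-cong-≗ λ x → cong (full y *_) (b-sym x y)) rows)) ⟩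
    sum (λ x → full x * sum (b x)) + sum (λ x → full x * sum (b x))
      ≡⟨ sym (∑-distrib-+ (λ x → full x * sum (b x)) _) ⟩
    sum (λ x → full x * sum (b x) + full x * sum (b x))
      ≤⟨ sum-mono full-degree-b ⟩
    sum (λ x → q * (full x * sum (m x)))
      ≡⟨ sym (*-distribˡ-sum q (λ x → full x * sum (m x))) ⟩
    q * sum (λ x → full x * sum (m x)) ∎
    where
    open ≤-Reasoning
    rows : ∑∑ (λ x y → full x * b x y) ≡ sum (λ x → full x * sum (b x))
    rows = sum-cong-≗ λ x → sym (*-distribˡ-sum (full x) (b x))

  ∑∑-split : sum (λ x → full x * sum (m x)) + ∑∑ m′ ≡ ∑∑ m
  ∑∑-split = trans (cong (sum (λ x → full x * sum (m x)) +_) ∑∑m′≡)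
    (trans (sym (∑-distrib-+ (λ x → full x * sum (m x)) _))
      (sum-cong-≗ λ x → trans (sym (*-distribʳ-+ (sum (m x)) (full x) (nonfull x)))
        (trans (cong (_* sum (m x)) (full+nonfull x)) (*-identityˡ _))))

  -- Adding the diagonal of `codegree` to both sides lowers the factor q + 1 of `∑∑-codegree≤` to q.
  -- The full and the other vertices then pay at the same rate q per unit of Maker degree.
  budget : ∑∑ b ≤ q * ∑∑ m
  budget = +-cancelʳ-≤ (∑∑ m′) _ _ (begin
    ∑∑ b + ∑∑ m′
      ≡⟨ cong (∑∑ b +_) (sym ∑∑-diagonal) ⟩
    ∑∑ b + ∑∑ (λ x y → δ x y * codegree x y)
      ≡⟨ sym (∑∑-distrib-+ b _) ⟩
    ∑∑ (λ x y → b x y + δ x y * codegree x y)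
      ≤⟨ sum-mono (λ x → sum-mono (pointwise x)) ⟩
    ∑∑ (λ x y → (full x * b x y + full y * b x y) + codegree x y)
      ≡⟨ ∑∑-distrib-+ (λ x y → full x * b x y + full y * b x y) codegree ⟩
    ∑∑ (λ x y → full x * b x y + full y * b x y) + ∑∑ codegree
      ≤⟨ +-mono-≤ ∑∑-full ∑∑-codegree≤ ⟩
    q * φ + suc q * ∑∑ m′
      ≡⟨ e q φ (∑∑ m′) ⟩
    q * (φ + ∑∑ m′) + ∑∑ m′
      ≡⟨ cong (λ s → q * s + ∑∑ m′) ∑∑-split ⟩
    q * ∑∑ m + ∑∑ m′ ∎)
    where
    open ≤-Reasoning
    φ = sum (λ x → full x * sum (m x))
    e : ∀ q φ κ → q * φ + suc q * κ ≡ q * (φ + κ) + κ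
    e = solve-∀

-- Edges and adjacency counts

δ≤1 : ∀ (x y : Fin n) → δ x y ≤ 1
δ≤1 x y = ⟦⟧≤1 (x Finₚ.≟ y)

1≤δ⇒≡ : ∀ {x y : Fin n} → 1 ≤ δ x y → x ≡ y
1≤δ⇒≡ {x = x} {y} 1≤δ with x Finₚ.≟ y
... | yes x≡y = x≡y

1≤*⇒ : ∀ {a b} → 1 ≤ a * b → 1 ≤ a × 1 ≤ b
1≤*⇒ {suc a} {suc b} _ = s≤s z≤n , s≤s z≤n
1≤*⇒ {suc a} {zero} p = contradiction (subst (1 ≤_) (*-zeroʳ a) p) λ ()

1≤+⇒ : ∀ a {b} → 1 ≤ a + b → 1 ≤ a ⊎ 1 ≤ b
1≤+⇒ zero    p = inj₂ p
1≤+⇒ (suc a) p = inj₁ (s≤s z≤n)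

edge-≡ : ∀ {e f : Edge n} → lo e ≡ lo f → hi e ≡ hi f → e ≡ f
edge-≡ refl refl = refl

_≟ₑ_ : DecidableEquality (Edge n)
e ≟ₑ f = map′ (λ (p , q) → edge-≡ p q) (λ { refl → refl , refl })
              (lo e Finₚ.≟ lo f ×-dec hi e Finₚ.≟ hi f)

-- The stored ordering proof is irrelevant; deciding `<` recovers a usable one.
lo<hi! : ∀ (e : Edge n) → lo e Fin.< hi e
lo<hi! (edge l h l<h) = recompute (l Finₚ.<? h) l<h

lo≢hi : ∀ (e : Edge n) → lo e ≢ hi e
lo≢hi e = Finₚ.<⇒≢ (lo<hi! e)

Joins : Edge n → Fin n → Fin n → Set
Joins e x y = (lo e ≡ x × hi e ≡ y) ⊎ (lo e ≡ y × hi e ≡ x)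

joins-sym : ∀ {e : Edge n} {x y} → Joins e x y → Joins e y x
joins-sym = Sum.swap

joins-irrefl : ∀ (e : Edge n) {x} → ¬ Joins e x x
joins-irrefl e (inj₁ (refl , p)) = lo≢hi e (sym p)
joins-irrefl e (inj₂ (refl , p)) = lo≢hi e (sym p)

joins-unique : ∀ (e f : Edge n) {x y} → Joins e x y → Joins f x y → e ≡ f
joins-unique e f (inj₁ (p , q)) (inj₁ (p′ , q′)) = edge-≡ (trans p (sym p′)) (trans q (sym q′))
joins-unique e f (inj₂ (p , q)) (inj₂ (p′ , q′)) = edge-≡ (trans p (sym p′)) (trans q (sym q′))
joins-unique e f (inj₁ (refl , refl)) (inj₂ (p , q)) =
  contradiction (subst₂ Fin._<_ p q (lo<hi! f)) (Finₚ.<-asym (lo<hi! e))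
joins-unique e f (inj₂ (refl , refl)) (inj₁ (p , q)) =
  contradiction (subst₂ Fin._<_ p q (lo<hi! f)) (Finₚ.<-asym (lo<hi! e))

joins-otherEnd : ∀ (e : Edge n) {u x y} → Joins e u x → Joins e x y → u ≡ y
joins-otherEnd e (inj₁ (p , q)) (inj₁ (p′ , q′)) = contradiction (trans p′ (sym q)) (lo≢hi e)
joins-otherEnd e (inj₁ (p , q)) (inj₂ (p′ , q′)) = trans (sym p) p′
joins-otherEnd e (inj₂ (p , q)) (inj₁ (p′ , q′)) = trans (sym q) q′
joins-otherEnd e (inj₂ (p , q)) (inj₂ (p′ , q′)) = contradiction (trans p (sym q′)) (lo≢hi e)

-- The adjacency matrix of a single edge, written with products of `δ` so that its row sums follow
-- from `sum-δ`.
incidence : Edge n → Fin n → Fin n → ℕ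
incidence e x y = δ (lo e) x * δ (hi e) y + δ (lo e) y * δ (hi e) x

incidence-sym : ∀ (e : Edge n) x y → incidence e x y ≡ incidence e y x
incidence-sym e x y = +-comm (δ (lo e) x * δ (hi e) y) _

joins⇒incidence : ∀ {e : Edge n} {x y} → Joins e x y → 1 ≤ incidence e x y
joins⇒incidence {e = e} (inj₁ (refl , refl)) rewrite δ-refl (lo e) | δ-refl (hi e) = s≤s z≤n
joins⇒incidence {e = e} (inj₂ (refl , refl)) rewrite δ-refl (lo e) | δ-refl (hi e) = m≤n+m 1 _

incidence⇒joins : ∀ (e : Edge n) {x y} → 1 ≤ incidence e x y → Joins e x y
incidence⇒joins e {x} {y} 1≤ = Sum.map ends ends (1≤+⇒ (δ (lo e) x * δ (hi e) y) 1≤)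
  where
  ends : ∀ {x y} → 1 ≤ δ (lo e) x * δ (hi e) y → lo e ≡ x × hi e ≡ y
  ends = Product.map 1≤δ⇒≡ 1≤δ⇒≡ ∘ 1≤*⇒ {δ (lo e) _}

-- Both products being 1 would force `lo e` and `hi e` to coincide.
incidence≤1 : ∀ (e : Edge n) x y → incidence e x y ≤ 1
incidence≤1 e x y with lo e Finₚ.≟ x | lo e Finₚ.≟ y
... | no _  | p =
  ≤-trans (≤-trans (*-monoˡ-≤ (δ (hi e) x) (⟦⟧≤1 p)) (≤-reflexive (+-identityʳ _))) (δ≤1 (hi e) x)
... | yes _ | no _ = ≤-trans (≤-reflexive (trans (+-identityʳ _) (+-identityʳ _))) (δ≤1 (hi e) y)
... | yes refl | yes refl rewrite δ-≢ (lo≢hi e ∘ sym) = z≤n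

incidence-degree : ∀ (e : Edge n) x → sum (incidence e x) ≡ δ (lo e) x + δ (hi e) x
incidence-degree e x = trans (∑-distrib-+ (λ y → δ (lo e) x * δ (hi e) y) _) (cong₂ _+_
  (trans (sym (*-distribˡ-sum (δ (lo e) x) (δ (hi e))))
    (trans (cong (δ (lo e) x *_) (sum-δ-1 (hi e))) (*-identityʳ _)))
  (sum-δ (lo e) (λ _ → δ (hi e) x)))

∑∑-incidence : ∀ (e : Edge n) → ∑∑ (incidence e) ≡ 2
∑∑-incidence e = trans (sum-cong-≗ (incidence-degree e))
  (trans (∑-distrib-+ (δ (lo e)) _) (cong₂ _+_ (sum-δ-1 (lo e)) (sum-δ-1 (hi e))))

-- Repeated edges count repeatedly, which makes this additive under `_++_`; for `Unique` lists the
-- entries are 0 or 1.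
adj : List (Edge n) → Fin n → Fin n → ℕ
adj []      x y = 0
adj (e ∷ L) x y = incidence e x y + adj L x y

degree : List (Edge n) → Fin n → ℕ
degree L x = sum (adj L x)

adj-sym : ∀ (L : List (Edge n)) x y → adj L x y ≡ adj L y x
adj-sym []      x y = refl
adj-sym (e ∷ L) x y = cong₂ _+_ (incidence-sym e x y) (adj-sym L x y)

adj-++ : ∀ (L K : List (Edge n)) x y → adj (L ++ K) x y ≡ adj L x y + adj K x y
adj-++ []      K x y = refl
adj-++ (e ∷ L) K x y = trans (cong (incidence e x y +_) (adj-++ L K x y)) (sym (+-assoc (incidence e x y) _ _))

∑∑-adj : ∀ (L : List (Edge n)) → ∑∑ (adj L) ≡ 2 * length L
∑∑-adj {n} [] = trans (sum-const n _) (trans (cong (n *_) (sum-replicate-zero n)) (*-zeroʳ n))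
∑∑-adj (e ∷ L) = trans (∑∑-distrib-+ (incidence e) (adj L))
  (trans (cong₂ _+_ (∑∑-incidence e) (∑∑-adj L)) (sym (*-distribˡ-+ 2 1 (length L))))

degree-∷ : ∀ (e : Edge n) L x → degree (e ∷ L) x ≡ (δ (lo e) x + δ (hi e) x) + degree L x
degree-∷ e L x = trans (∑-distrib-+ (incidence e x) (adj L x)) (cong (_+ degree L x) (incidence-degree e x))

∈⇒adj : ∀ {L : List (Edge n)} {e x y} → e ∈ L → Joins e x y → 1 ≤ adj L x y
∈⇒adj {e = e} (here refl) j = ≤-trans (joins⇒incidence {e = e} j) (m≤m+n _ _)
∈⇒adj {L = f ∷ L} {x = x} {y} (there e∈L) j = ≤-trans (∈⇒adj e∈L j) (m≤n+m (adj L x y) (incidence f x y))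

adj⇒∈ : ∀ (L : List (Edge n)) {x y} → 1 ≤ adj L x y → ∃[ e ] e ∈ L × Joins e x y
adj⇒∈ (e ∷ L) {x} {y} 1≤ with 1≤+⇒ (incidence e x y) 1≤
... | inj₁ i = e , here refl , incidence⇒joins e i
... | inj₂ a = let f , f∈L , j = adj⇒∈ L a in f , there f∈L , j

adj-diagonal : ∀ (L : List (Edge n)) x → adj L x x ≡ 0
adj-diagonal L x with 1 ≤? adj L x x
... | no ¬1≤ = n<1⇒n≡0 (≰⇒> ¬1≤)
... | yes 1≤ = let e , _ , j = adj⇒∈ L 1≤ in contradiction j (joins-irrefl e)

adj≤1 : ∀ {L : List (Edge n)} → Unique L → ∀ x y → adj L x y ≤ 1
adj≤1 [] x y = z≤n
adj≤1 {L = e ∷ L} (e∉L ∷ L!) x y with 1 ≤? incidence e x y | 1 ≤? adj L x y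
... | no ¬1≤ | _ rewrite n<1⇒n≡0 (≰⇒> ¬1≤) = adj≤1 L! x y
... | yes _  | no ¬1≤ rewrite n<1⇒n≡0 (≰⇒> ¬1≤) | +-identityʳ (incidence e x y) = incidence≤1 e x y
... | yes i  | yes a = let f , f∈L , j = adj⇒∈ L a in
  contradiction (joins-unique e f (incidence⇒joins e i) j) (All.lookup e∉L f∈L)

δ+adj≤1 : ∀ {L : List (Edge n)} → Unique L → ∀ x y → δ x y + adj L x y ≤ 1
δ+adj≤1 {L = L} L! x y = go (x Finₚ.≟ y)
  where
  go : Dec (x ≡ y) → δ x y + adj L x y ≤ 1
  go (yes refl) rewrite adj-diagonal L x | +-identityʳ (δ x x) = δ≤1 x x
  go (no x≢y) rewrite δ-≢ x≢y = adj≤1 L! x y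

-- Enumeration of the edges.

edgeBetween : Fin n × Fin n → List (Edge n)
edgeBetween (i , j) with i Finₚ.<? j
... | yes i<j = edge i j i<j ∷ []
... | no  _   = []

∈-edgeBetween : ∀ (e : Edge n) → e ∈ edgeBetween (lo e , hi e)
∈-edgeBetween e with lo e Finₚ.<? hi e
... | yes _   = here refl
... | no  l≮h = contradiction (lo<hi! e) l≮h

-- `deduplicate` yields uniqueness without any reasoning about the product list.
allEdges : ∀ n → List (Edge n)
allEdges n = deduplicate _≟ₑ_ (concatMap edgeBetween (cartesianProduct (allFin n) (allFin n)))

∈-allEdges : ∀ (e : Edge n) → e ∈ allEdges n
∈-allEdges e = ∈-deduplicate⁺ _≟ₑ_ (∈-concatMap⁺ edgeBetween
  (lose (∈-cartesianProduct⁺ (∈-allFin (lo e)) (∈-allFin (hi e))) (∈-edgeBetween e)))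

allEdges! : ∀ n → Unique (allEdges n)
allEdges! n = DecUnique.deduplicate-! _≟ₑ_ _

-- Positions in which no edge is claimed twice.

record Proper (h : History n) : Set where
  field
    maker!   : Unique (makerEdges h)
    breaker! : Unique (breakerEdges h)
    disjoint : Disjoint (makerEdges h) (breakerEdges h)

open Proper

proper-[] : Proper {n} []
proper-[] = record { maker! = [] ; breaker! = [] ; disjoint = λ () }

proper-∷ : ∀ {h : History n} {e bs} → Proper h → Unclaimed h e →
           Unique bs → All (Unclaimed h) bs → e ∉ bs → Proper ((e , bs) ∷ h)
proper-∷ {h = h} {e} {bs} P e-free bs! bs-free e∉bs = record
  { maker!   = ¬Any⇒All¬ _ (e-free ∘ inj₁) ∷ maker! P
  ; breaker! = Unique.++⁺ bs! (breaker! P) (λ (f∈bs , f∈B) → All.lookup bs-free f∈bs (inj₂ f∈B))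
  ; disjoint = λ where
      (here refl , f∈) → [ e∉bs , e-free ∘ inj₂ ]′ (∈-++⁻ bs f∈)
      (there f∈M , f∈) → [ (λ f∈bs → All.lookup bs-free f∈bs (inj₁ f∈M))
                         , (λ f∈B → disjoint P (f∈M , f∈B)) ]′ (∈-++⁻ bs f∈)
  }

-- One inequality packs together that there are no loops, no repeated edges and no edge owned by
-- both players. It is `δ+adj≤1` for the two edge lists appended.
δ+adj+adj≤1 : ∀ {h : History n} → Proper h → ∀ x y →
              δ x y + (adj (makerEdges h) x y + adj (breakerEdges h) x y) ≤ 1
δ+adj+adj≤1 {h = h} P x y = subst (λ a → δ x y + a ≤ 1) (adj-++ (makerEdges h) (breakerEdges h) x y)
  (δ+adj≤1 (Unique.++⁺ (maker! P) (breaker! P) (disjoint P)) x y)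

-- Breaker's strategy

Claimed? : ∀ (h : History n) e → Dec (Claimed h e)
Claimed? h e = e ∈? makerEdges h ⊎-dec e ∈? breakerEdges h
  where open DecMembership _≟ₑ_ using (_∈?_)

module Breaker (n q : ℕ) (n-bound : 2 * n ≤ suc q * suc (suc q) + 2) where

  -- If Maker took an edge of this kind, a degree would exceed q + 1 or a triangle would close. The
  -- three cases are those of `reason` in `Budget`.
  Dangerous : List (Edge n) → Fin n → Fin n → Set
  Dangerous M x y = suc q ≤ degree M x ⊎ suc q ≤ degree M y ⊎
                    ∃[ u ] (1 ≤ adj M u x × 1 ≤ adj M u y)

  Dangerous? : ∀ M x y → Dec (Dangerous M x y)
  Dangerous? M x y = (suc q ≤? degree M x) ⊎-dec (suc q ≤? degree M y) ⊎-dec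
                     Finₚ.any? (λ u → (1 ≤? adj M u x) ×-dec (1 ≤? adj M u y))

  dangerous-sym : ∀ {M x y} → Dangerous M x y → Dangerous M y x
  dangerous-sym (inj₁ f)                       = inj₂ (inj₁ f)
  dangerous-sym (inj₂ (inj₁ f))                = inj₁ f
  dangerous-sym (inj₂ (inj₂ (u , ux , uy)))    = inj₂ (inj₂ (u , uy , ux))

  dangerous-ends : ∀ {M e x y} → Joins e x y → Dangerous M x y → Dangerous M (lo e) (hi e)
  dangerous-ends (inj₁ (refl , refl)) = id
  dangerous-ends {M} (inj₂ (refl , refl)) = dangerous-sym {M}

  dangerous-ends⁻ : ∀ {M e x y} → Joins e x y → Dangerous M (lo e) (hi e) → Dangerous M x y
  dangerous-ends⁻ (inj₁ (refl , refl)) = id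
  dangerous-ends⁻ {M} (inj₂ (refl , refl)) = dangerous-sym {M}

  -- Degrees and adjacency counts only grow, so edges that Breaker claimed earlier keep their
  -- justification.
  dangerous-∷ : ∀ {e M x y} → Dangerous M x y → Dangerous (e ∷ M) x y
  dangerous-∷ {e} {M} {x} {y} = Sum.map (λ f → ≤-trans f (grow x))
    (Sum.map (λ f → ≤-trans f (grow y))
      λ (u , ux , uy) → u , ≤-trans ux (m≤n+m _ (incidence e u x))
                          , ≤-trans uy (m≤n+m _ (incidence e u y)))
    where
    grow : ∀ x → degree M x ≤ degree (e ∷ M) x
    grow x = sum-mono λ y → m≤n+m _ (incidence e x y)

  -- Danger is judged after Maker's move `e`, but `Unclaimed h` before it, so `e` is excluded
  -- separately.
  Wanted : History n → Edge n → Edge n → Set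
  Wanted h e f = Unclaimed h f × f ≢ e × Dangerous (e ∷ makerEdges h) (lo f) (hi f)

  Wanted? : ∀ h e f → Dec (Wanted h e f)
  Wanted? h e f = ¬? (Claimed? h f) ×-dec ¬? (f ≟ₑ e) ×-dec Dangerous? (e ∷ makerEdges h) (lo f) (hi f)

  strategy : BreakerStrategy n
  strategy h e = filter (Wanted? h e) (allEdges n)

  reply⇒wanted : ∀ h e {f} → f ∈ strategy h e → Wanted h e f
  reply⇒wanted h e = proj₂ ∘ ∈-filter⁻ (Wanted? h e) {xs = allEdges n}

  -- `dangerous⇒claimed` keeps Maker's next edge safe and so preserves the last two fields;
  -- `breaker⇒dangerous` supplies the reasons for the budget count.
  record Invariant (h : History n) : Set where
    field
      proper            : Proper h
      dangerous⇒claimed : ∀ f → Dangerous (makerEdges h) (lo f) (hi f) → Claimed h f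
      breaker⇒dangerous : ∀ {f} → f ∈ breakerEdges h → Dangerous (makerEdges h) (lo f) (hi f)
      triangle-free     : ∀ {x y u} → 1 ≤ adj (makerEdges h) x y → 1 ≤ adj (makerEdges h) u x →
                          1 ≤ adj (makerEdges h) u y → ⊥
      degree≤           : ∀ x → degree (makerEdges h) x ≤ suc q

  open Invariant

  sum-0 : sum {n} (λ _ → 0) ≡ 0
  sum-0 = sum-replicate-zero n

  invariant-[] : Invariant []
  invariant-[] = record
    { proper            = proper-[]
    ; dangerous⇒claimed = λ f → λ where
        (inj₁ d) → contradiction (subst (suc q ≤_) sum-0 d) λ ()
        (inj₂ (inj₁ d)) → contradiction (subst (suc q ≤_) sum-0 d) λ ()
    ; breaker⇒dangerous = λ ()
    ; triangle-free     = λ ()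
    ; degree≤           = λ x → subst (_≤ suc q) (sym sum-0) z≤n
    }

  reply-unique : ∀ h e → Unique (strategy h e)
  reply-unique h e = Unique.filter⁺ (Wanted? h e) (allEdges! n)

  reply-unclaimed : ∀ h e → All (Unclaimed h) (strategy h e)
  reply-unclaimed h e = All.tabulate (proj₁ ∘ reply⇒wanted h e)

  reply-not-e : ∀ h e → e ∉ strategy h e
  reply-not-e h e e∈ = proj₁ (proj₂ (reply⇒wanted h e e∈)) refl

  module _ {h : History n} {e : Edge n} (I : Invariant h) (e-free : Unclaimed h e) where

    private
      M = makerEdges h

      -- Every dangerous edge was already claimed when the previous round ended.
      e-harmless : ∀ {x y} → Joins e x y → ¬ Dangerous M x y
      e-harmless j d = e-free (dangerous⇒claimed I e (dangerous-ends {M} {e} j d))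

      adj-∷ : ∀ {x y} → 1 ≤ adj (e ∷ M) x y → Joins e x y ⊎ 1 ≤ adj M x y
      adj-∷ {x} {y} = Sum.map₁ (incidence⇒joins e) ∘ 1≤+⇒ (incidence e x y)

      reverse : ∀ {x y} → 1 ≤ adj (e ∷ M) x y → 1 ≤ adj (e ∷ M) y x
      reverse {x} {y} = subst (1 ≤_) (adj-sym (e ∷ M) x y)

      loopless : ∀ {x} → ¬ (1 ≤ adj (e ∷ M) x x)
      loopless {x} a = contradiction (subst (1 ≤_) (adj-diagonal (e ∷ M) x) a) λ ()

      -- A second side equal to `e` would collapse the triangle to a loop. Otherwise `u` was a
      -- common neighbour before the move, and `e` was dangerous.
      no-triangle-on-e : ∀ {x y u} → Joins e x y → 1 ≤ adj (e ∷ M) u x → 1 ≤ adj (e ∷ M) u y → ⊥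
      no-triangle-on-e j ux uy with adj-∷ ux | adj-∷ uy
      ... | inj₁ j′  | _ with refl ← joins-otherEnd e j′ j = loopless uy
      ... | inj₂ _   | inj₁ j′ with refl ← joins-otherEnd e j′ (joins-sym {e = e} j) = loopless ux
      ... | inj₂ ux′ | inj₂ uy′ = e-harmless j (inj₂ (inj₂ (_ , ux′ , uy′)))

      triangle-free-∷ : ∀ {x y u} → 1 ≤ adj (e ∷ M) x y → 1 ≤ adj (e ∷ M) u x → 1 ≤ adj (e ∷ M) u y → ⊥
      triangle-free-∷ xy ux uy with adj-∷ xy | adj-∷ ux | adj-∷ uy
      ... | inj₁ j   | _        | _        = no-triangle-on-e j ux uy
      -- The triangle is rotated so that its side `e` comes first.
      ... | inj₂ _   | inj₁ j   | _        = no-triangle-on-e j (reverse uy) (reverse xy)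
      ... | inj₂ _   | inj₂ _   | inj₁ j   = no-triangle-on-e j (reverse ux) xy
      ... | inj₂ xy′ | inj₂ ux′ | inj₂ uy′ = triangle-free I xy′ ux′ uy′

      degree≤q : ∀ {x} → ¬ (suc q ≤ degree M x) → degree M x ≤ q
      degree≤q = ≤-pred ∘ ≰⇒>

      -- Only the ends of `e` gain a neighbour, and a full end would have made `e` dangerous.
      degree≤-∷ : ∀ x → degree (e ∷ M) x ≤ suc q
      degree≤-∷ x rewrite degree-∷ e M x = go (lo e Finₚ.≟ x) (hi e Finₚ.≟ x)
        where
        go : Dec (lo e ≡ x) → Dec (hi e ≡ x) → (δ (lo e) x + δ (hi e) x) + degree M x ≤ suc q
        go (yes refl) _ rewrite δ-≢ (lo≢hi e ∘ sym) | δ-refl (lo e) =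
          s≤s (degree≤q λ full → e-harmless (inj₁ (refl , refl)) (inj₁ full))
        go (no l≢x) (yes refl) rewrite δ-≢ l≢x | δ-refl (hi e) =
          s≤s (degree≤q λ full → e-harmless (inj₁ (refl , refl)) (inj₂ (inj₁ full)))
        go (no l≢x) (no h≢x) rewrite δ-≢ l≢x | δ-≢ h≢x = degree≤ I x

      claimed-∷ : ∀ f → Dangerous (e ∷ M) (lo f) (hi f) → Claimed ((e , strategy h e) ∷ h) f
      claimed-∷ f d with f ≟ₑ e | Claimed? h f
      ... | yes refl | _              = inj₁ (here refl)
      ... | no _     | yes (inj₁ f∈M) = inj₁ (there f∈M)
      ... | no _     | yes (inj₂ f∈B) = inj₂ (∈-++⁺ʳ (strategy h e) f∈B)
      ... | no f≢e   | no f-free      =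
        inj₂ (∈-++⁺ˡ (∈-filter⁺ (Wanted? h e) (∈-allEdges f) (f-free , f≢e , d)))

      dangerous-reply : ∀ {f} → f ∈ strategy h e ++ breakerEdges h → Dangerous (e ∷ M) (lo f) (hi f)
      dangerous-reply {f} f∈ with ∈-++⁻ (strategy h e) f∈
      ... | inj₁ f∈bs = proj₂ (proj₂ (reply⇒wanted h e f∈bs))
      ... | inj₂ f∈B  = dangerous-∷ {e} {M} {lo f} {hi f} (breaker⇒dangerous I f∈B)

    invariant-∷ : Invariant ((e , strategy h e) ∷ h)
    invariant-∷ = record
      { proper            = proper-∷ (proper I) e-free (reply-unique h e) (reply-unclaimed h e) (reply-not-e h e)
      ; dangerous⇒claimed = claimed-∷
      ; breaker⇒dangerous = λ {f} → dangerous-reply {f}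
      ; triangle-free     = triangle-free-∷
      ; degree≤           = degree≤-∷
      }

  invariant : ∀ {h} → PlayedBy strategy h → Invariant h
  invariant start            = invariant-[]
  invariant (round p e-free) = invariant-∷ (invariant p) e-free

  -- The bound depends on the two final graphs alone, not on the order of play. Ordered pairs count
  -- every edge twice, hence the factor 2.
  within-budget : ∀ {h} → Invariant h → length (breakerEdges h) ≤ q * length (makerEdges h)
  within-budget {h} I = *-cancelˡ-≤ 2 (begin
    2 * length B      ≡⟨ ∑∑-adj B ⟨
    ∑∑ (adj B)        ≤⟨ Budget.budget (adj M) (adj B) (adj-sym M) (adj-sym B)
                           (δ+adj+adj≤1 (proper I)) n-bound (degree≤ I) reason ⟩
    q * ∑∑ (adj M)    ≡⟨ cong (q *_) (∑∑-adj M) ⟩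
    q * (2 * length M) ≡⟨ e q (length M) ⟩
    2 * (q * length M) ∎)
    where
    open ≤-Reasoning
    M = makerEdges h
    B = breakerEdges h
    reason : ∀ x y → 1 ≤ adj B x y → Dangerous M x y
    reason x y 1≤ = let f , f∈B , j = adj⇒∈ B 1≤ in dangerous-ends⁻ {M} {f} j (breaker⇒dangerous I f∈B)
    e : ∀ q l → q * (2 * l) ≡ 2 * (q * l)
    e = solve-∀

  winning : Winning q strategy
  winning = record
    { legal = λ {h} {e} p e-free → record
      { distinct  = reply-unique h e
      ; unclaimed = reply-unclaimed h e
      ; not-e     = reply-not-e h e
      ; budget    = within-budget (invariant-∷ (invariant p) e-free)
      }
    ; wins = λ p all-claimed i j k i<j j<k → hit p
        (all-claimed (edge i j i<j)) (all-claimed (edge j k j<k)) (all-claimed (edge i k (Finₚ.<-trans i<j j<k)))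
    }
    where
    hit : ∀ {h i j k} .{i<j : i Fin.< j} .{j<k : j Fin.< k} .{i<k : i Fin.< k} → PlayedBy strategy h →
          Claimed h (edge i j i<j) → Claimed h (edge j k j<k) → Claimed h (edge i k i<k) →
          edge i j i<j ∈ breakerEdges h ⊎ edge j k j<k ∈ breakerEdges h ⊎ edge i k i<k ∈ breakerEdges h
    hit p (inj₂ ij) _         _         = inj₁ ij
    hit p (inj₁ _)  (inj₂ jk) _         = inj₂ (inj₁ jk)
    hit p (inj₁ _)  (inj₁ _)  (inj₂ ik) = inj₂ (inj₂ ik)
    hit p (inj₁ ij) (inj₁ jk) (inj₁ ik) = contradiction
      (∈⇒adj ik (inj₁ (refl , refl)))
      (λ a → triangle-free (invariant p) (∈⇒adj jk (inj₁ (refl , refl))) (∈⇒adj ij (inj₁ (refl , refl))) a)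

-- Maker's star

-- This is (d − p) (d − p − 1) ≥ 0, which holds for all integers.
parabola : ∀ p d → (2 * p + 1) * d ≤ d * d + p * suc p
parabola p d with d ≤? p
... | yes d≤p with t , refl ← m≤n⇒∃[o]m+o≡n d≤p = ≤-trans (m≤m+n _ (t * suc t)) (≤-reflexive (e d t))
  where
  e : ∀ d t → (2 * (d + t) + 1) * d + t * suc t ≡ d * d + (d + t) * suc (d + t)
  e = solve-∀
... | no d≰p with t , refl ← m≤n⇒∃[o]m+o≡n (≰⇒> d≰p) = ≤-trans (m≤m+n _ (t * suc t)) (≤-reflexive (e p t))
  where
  e : ∀ p t → (2 * p + 1) * (suc p + t) + t * suc t ≡ (suc p + t) * (suc p + t) + p * suc p
  e = solve-∀

-- Each edge of the star adds one to the degree of its centre. Testing `lo` suffices because the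
-- centre will be `zero`.
degree≡length : ∀ (v : Fin n) L → (∀ {e} → e ∈ L → lo e ≡ v) → degree L v ≡ length L
degree≡length {n} v []  _   = sum-replicate-zero n
degree≡length v (e ∷ L) at-v with refl ← at-v (here refl) = trans (degree-∷ e L v) (cong₂ _+_
  (cong₂ _+_ (δ-refl v) (δ-≢ (lo≢hi e ∘ sym)))
  (degree≡length v L (at-v ∘ there)))

-- m is the indicator of the leaves of Maker's star at v.
module StarCount (v : Fin n) (m : Fin n → ℕ) (b : Fin n → Fin n → ℕ)
  (m-centre : m v ≡ 0) (m≤1 : ∀ x → m x ≤ 1) (b-sym : ∀ x y → b x y ≡ b y x)
  (spokes : ∀ x → x ≢ v → 1 ≤ b v x + m x)
  (leaves : ∀ x y → x ≢ y → 1 ≤ m x → 1 ≤ m y → 1 ≤ b x y)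
  where

  leaf-pair : ∀ x y → x ≢ y → m x * m y ≤ b x y
  leaf-pair x y x≢y with 1 ≤? m x * m y
  ... | no ¬1≤ rewrite n<1⇒n≡0 (≰⇒> ¬1≤) = z≤n
  ... | yes 1≤ = let 1≤mx , 1≤my = 1≤*⇒ {m x} 1≤ in
    ≤-trans (*-mono-≤ (m≤1 x) (m≤1 y)) (leaves x y x≢y 1≤mx 1≤my)

  -- Summed over x and y this is d (d − 1) + 2 (n − 1 − d) ≤ ∑∑ b; the δ-terms cancel the
  -- pairs x = y and the leaves among the pairs through v.
  pointwise : ∀ x y → m x * m y + (δ v x + δ v y) ≤
    b x y + (δ x y * m y + (δ v x * (δ v y + m y) + δ v y * (δ v x + m x)))
  pointwise x y = go (v Finₚ.≟ x) (v Finₚ.≟ y)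
    where
    distinct : Dec (x ≡ y) → m x * m y + 0 ≤ b x y + (δ x y * m y + 0)
    distinct (yes refl) rewrite δ-refl x | m≤1⇒m*m≡m (m≤1 x) | +-identityʳ (m x)
      | +-identityʳ (m x) = m≤n+m _ (b x x)
    distinct (no x≢y) = +-mono-≤ (leaf-pair x y x≢y) z≤n
    go : Dec (v ≡ x) → Dec (v ≡ y) → m x * m y + (δ v x + δ v y) ≤
         b x y + (δ x y * m y + (δ v x * (δ v y + m y) + δ v y * (δ v x + m x)))
    -- At x = y = v the 2 on the left is matched by the two products of `δ v x` and `δ v y`.
    go (yes refl) (yes refl) rewrite δ-refl v | m-centre = m≤n+m 2 (b v v)
    go (yes refl) (no v≢y) rewrite δ-refl v | m-centre | δ-≢ v≢y
      | +-identityʳ (m y + 0) | +-identityʳ (m y) = spokes y (v≢y ∘ sym)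
    go (no v≢x) (yes refl) rewrite δ-refl v | m-centre | δ-≢ v≢x | δ-≢ (v≢x ∘ sym) | *-zeroʳ (m x)
      | +-identityʳ (m x) | b-sym x v = spokes x (v≢x ∘ sym)
    go (no v≢x) (no v≢y) rewrite δ-≢ v≢x | δ-≢ v≢y = distinct (x Finₚ.≟ y)

  d : ℕ
  d = sum m

  ∑∑-lhs : ∑∑ (λ x y → m x * m y + (δ v x + δ v y)) ≡ d * d + 2 * n
  ∑∑-lhs = trans (∑∑-distrib-+ (λ x y → m x * m y) (λ x y → δ v x + δ v y)) (cong₂ _+_
    (sum*sum m m)
    (trans (∑∑-distrib-+ (λ x y → δ v x) (λ x y → δ v y))
      (trans (cong₂ _+_ (trans (∑-comm {n} {n} (λ x y → δ v x)) columns) columns)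
        (cong (n +_) (sym (+-identityʳ n))))))
    where
    columns : sum {n} (λ _ → sum (δ v)) ≡ n
    columns = trans (sum-const n _) (trans (cong (n *_) (sum-δ-1 v)) (*-identityʳ n))

  -- The diagonal contributes `d`; the row and the column of `v` contribute `1 + d` each.
  ∑∑-rhs : ∑∑ (λ x y → b x y + (δ x y * m y + (δ v x * (δ v y + m y) + δ v y * (δ v x + m x)))) ≡
           ∑∑ b + (d + ((1 + d) + (1 + d)))
  ∑∑-rhs = trans (∑∑-distrib-+ b _) (cong (∑∑ b +_)
    (trans (∑∑-distrib-+ (λ x y → δ x y * m y) _) (cong₂ _+_ (sum-cong-≗ (λ x → sum-δ x m))
      (trans (∑∑-distrib-+ (λ x y → δ v x * (δ v y + m y)) (λ x y → δ v y * (δ v x + m x)))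
        (cong₂ _+_ row (trans (∑-comm (λ x y → δ v y * (δ v x + m x))) row))))))
    where
    row : ∑∑ (λ x y → δ v x * (δ v y + m y)) ≡ 1 + d
    row = trans (sum*sum (δ v) (λ y → δ v y + m y))
      (trans (cong₂ _*_ (sum-δ-1 v) (trans (∑-distrib-+ (δ v) m) (cong (_+ d) (sum-δ-1 v))))
        (*-identityˡ _))

  star-count : d * d + 2 * n ≤ ∑∑ b + (d + ((1 + d) + (1 + d)))
  star-count = subst₂ _≤_ ∑∑-lhs ∑∑-rhs (sum-mono (λ x → sum-mono (pointwise x)))

module Maker {k q : ℕ} {σ : BreakerStrategy (suc k)} (W : Winning q σ) where

  open Winning W
  open LegalReply

  private
    E = Edge (suc k)
    H = History (suc k)

  proper : ∀ {h} → PlayedBy σ h → Proper h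
  proper start          = proper-[]
  proper (round p free) = let r = legal p free in
    proper-∷ (proper p) free (distinct r) (unclaimed r) (not-e r)

  -- The outcome when Maker works through `es`, skipping claimed edges. It serves both to build the
  -- star and, with `allEdges`, to play to the end.
  record Continuation (h : H) (es : List E) : Set where
    field
      {final}   : H
      played    : PlayedBy σ final
      extends   : makerEdges h ⊆ makerEdges final
      new       : ∀ {f} → f ∈ makerEdges final → f ∈ makerEdges h ⊎ f ∈ es
      persists  : ∀ {f} → Claimed h f → Claimed final f
      exhausted : ∀ {f} → f ∈ es → Claimed final f

  open Continuation

  claim : ∀ es {h} → PlayedBy σ h → Continuation h es
  claim [] p = record
    { played = p ; extends = id ; new = inj₁ ; persists = id ; exhausted = λ () }
  claim (e ∷ es) {h} p with Claimed? h e
  ... | yes e-claimed = record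
    { played = played C ; extends = extends C ; new = Sum.map₂ there ∘ new C ; persists = persists C
    ; exhausted = λ { (here refl) → persists C e-claimed ; (there f∈) → exhausted C f∈ }
    }
    where C = claim es p
  ... | no e-free = record
    { played    = played C
    ; extends   = extends C ∘ there
    ; new       = [ (λ { (here refl) → inj₂ (here refl) ; (there f∈) → inj₁ f∈ }) , inj₂ ∘ there ]′ ∘ new C
    ; persists  = persists C ∘ persists-round
    ; exhausted = λ { (here refl) → persists C (inj₁ (here refl)) ; (there f∈) → exhausted C f∈ }
    }
    where
    C = claim es (round p e-free)
    persists-round : ∀ {f} → Claimed h f → Claimed ((e , σ h e) ∷ h) f
    persists-round = Sum.map there (∈-++⁺ʳ (σ h e))

  -- `wins` speaks of finished games, so play continues until all edges are claimed. Breaker then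
  -- holds a side of the triangle, yet all three sides are still Maker's.
  no-maker-triangle : ∀ {h x y} .{0<x : zero {k} Fin.< x} .{x<y : x Fin.< y} .{0<y : zero {k} Fin.< y} →
    PlayedBy σ h →
    edge zero x 0<x ∈ makerEdges h → edge x y x<y ∈ makerEdges h →
    edge zero y 0<y ∈ makerEdges h → ⊥
  no-maker-triangle {x = x} {y} {0<x} {x<y} p 0x xy 0y =
    [ (λ b → disjoint P (extends C 0x , b))
    , [ (λ b → disjoint P (extends C xy , b)) , (λ b → disjoint P (extends C 0y , b)) ]′ ]′
      (wins (played C) (λ e → exhausted C (∈-allEdges e)) zero x y
        (recompute (zero {k} Finₚ.<? x) 0<x) (recompute (x Finₚ.<? y) x<y))
    where
    C = claim (allEdges _) p
    P = proper (played C)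

  lo≟0 : ∀ (e : E) → Dec (lo e ≡ zero)
  lo≟0 e = lo e Finₚ.≟ zero

  star : Continuation [] (filter lo≟0 (allEdges _))
  star = claim _ start

  M B : List E
  M = makerEdges (final star)
  B = breakerEdges (final star)

  M-star : ∀ {e} → e ∈ M → lo e ≡ zero
  M-star e∈M with inj₂ e∈ ← new star e∈M = proj₂ (∈-filter⁻ lo≟0 {xs = allEdges _} e∈)

  spokes-claimed : ∀ j → 1 ≤ adj B zero (suc j) + adj M zero (suc j)
  spokes-claimed j with exhausted star (∈-filter⁺ lo≟0 (∈-allEdges (edge zero (suc j) (s≤s z≤n))) refl)
  ... | inj₁ e∈M = ≤-trans (∈⇒adj e∈M (inj₁ (refl , refl))) (m≤n+m _ (adj B zero (suc j)))
  ... | inj₂ e∈B = ≤-trans (∈⇒adj e∈B (inj₁ (refl , refl))) (m≤m+n _ _)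

  spoke : ∀ {y} → 1 ≤ adj M zero (suc y) → edge zero (suc y) (s≤s z≤n) ∈ M
  spoke {y} a with adj⇒∈ M a
  ... | e , e∈M , inj₁ (refl , refl) = e∈M
  ... | e , e∈M , inj₂ (p , q) = contradiction (trans (sym (M-star e∈M)) p) λ ()

  -- Were the edge between two leaves free, Maker would claim it and complete a triangle; it is not
  -- hers already, as all her edges contain `zero`.
  leaves-joined : ∀ {x y} → x Fin.< y → 1 ≤ adj M zero (suc x) → 1 ≤ adj M zero (suc y) →
                  1 ≤ adj B (suc x) (suc y)
  leaves-joined {x} {y} x<y ax ay with Claimed? (final star) (edge (suc x) (suc y) (s≤s x<y))
  ... | yes (inj₂ e∈B) = ∈⇒adj e∈B (inj₁ (refl , refl))
  ... | yes (inj₁ e∈M) = contradiction (M-star e∈M) λ ()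
  ... | no e-free = contradiction (there (spoke ay))
    (no-maker-triangle (round (played star) e-free) (there (spoke ax)) (here refl))

  d : ℕ
  d = degree M zero

  spokes : ∀ y → y ≢ zero → 1 ≤ adj B zero y + adj M zero y
  spokes zero    0≢0 = contradiction refl 0≢0
  spokes (suc y) _   = spokes-claimed y

  leaves : ∀ x y → x ≢ y → 1 ≤ adj M zero x → 1 ≤ adj M zero y → 1 ≤ adj B x y
  leaves zero    y       _     a _ = contradiction (subst (1 ≤_) (adj-diagonal M zero) a) λ ()
  leaves (suc x) zero    _     _ a = contradiction (subst (1 ≤_) (adj-diagonal M zero) a) λ ()
  leaves (suc x) (suc y) x≢y a a′ with Finₚ.<-cmp x y
  ... | tri< x<y _ _ = leaves-joined x<y a a′
  ... | tri≈ _ x≡y _ = contradiction (cong suc x≡y) x≢y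
  ... | tri> _ _ y<x = subst (1 ≤_) (adj-sym B (suc y) (suc x)) (leaves-joined y<x a′ a)

  within-budget : ∀ {h} → PlayedBy σ h → length (breakerEdges h) ≤ q * length (makerEdges h)
  within-budget start          = z≤n
  within-budget (round p free) = budget (legal p free)

  -- `star-count` bounds Breaker's edges from below and the budget bounds them by q d. Since `d` is
  -- Breaker's to influence, `parabola` at p = q + 1 removes it.
  bound : 2 * k ≤ suc q * suc (suc q)
  bound = +-cancelʳ-≤ (d * d + 2) _ _ (begin
    2 * k + (d * d + 2)                            ≡⟨ e₁ k d ⟩
    d * d + 2 * suc k                              ≤⟨ star-count ⟩
    ∑∑ (adj B) + (d + ((1 + d) + (1 + d)))         ≡⟨ cong (_+ (d + ((1 + d) + (1 + d)))) (∑∑-adj B) ⟩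
    2 * length B + (d + ((1 + d) + (1 + d)))       ≤⟨ +-monoˡ-≤ _ (*-monoʳ-≤ 2 (within-budget (played star))) ⟩
    2 * (q * length M) + (d + ((1 + d) + (1 + d))) ≡⟨ cong (λ l → 2 * (q * l) + (d + ((1 + d) + (1 + d))))
                                                         (degree≡length zero M M-star) ⟨
    2 * (q * d) + (d + ((1 + d) + (1 + d)))        ≡⟨ e₂ q d ⟩
    (2 * suc q + 1) * d + 2                        ≤⟨ +-monoˡ-≤ 2 (parabola (suc q) d) ⟩
    d * d + suc q * suc (suc q) + 2                ≡⟨ e₃ (d * d) (suc q * suc (suc q)) ⟩
    suc q * suc (suc q) + (d * d + 2)              ∎)
    where
    open ≤-Reasoning
    open StarCount zero (adj M zero) (adj B) (adj-diagonal M zero)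
      (adj≤1 (maker! (proper (played star))) zero) (adj-sym B) spokes leaves using (star-count)
    e₁ : ∀ k d → 2 * k + (d * d + 2) ≡ d * d + 2 * suc k
    e₁ = solve-∀
    e₂ : ∀ q d → 2 * (q * d) + (d + ((1 + d) + (1 + d))) ≡ (2 * suc q + 1) * d + 2
    e₂ = solve-∀
    e₃ : ∀ a c → a + c + 2 ≡ c + (a + 2)
    e₃ = solve-∀

-- The ceiling

open import Data.Integer.Base using (+_)

-- The hypothesis says that k + 3/2 is a/2. As `a` is natural, the negative clause of `√` cannot
-- hold, and squaring gives a²/4 < N.
below-√-3/2 : ∀ N k a → k ℤ.* + 2 ℤ.+ + 3 ≡ + a →
              (k / 1) <ᶜ (√ ((+ N) / 1) -ᶜ ((+ 3) / 2)) ⇔ a * a < 4 * N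
below-√-3/2 N k a eq = mk⇔ to from
  where
  lhs : + a ℤ.* + a ℤ.* + 1 ≡ + (a * a)
  lhs = trans (ℤₚ.*-identityʳ _) (sym (ℤₚ.pos-* a a))
  rhs : + N ℤ.* + 4 ≡ + (4 * N)
  rhs = trans (sym (ℤₚ.pos-* N 4)) (cong +_ (*-comm N 4))
  to : (k / 1) <ᶜ (√ ((+ N) / 1) -ᶜ ((+ 3) / 2)) → a * a < 4 * N
  to (inj₁ (*<* lt)) rewrite eq = contradiction (subst (ℤ._< + 0) (ℤₚ.*-identityʳ (+ a)) lt) λ { (ℤ.+<+ ()) }
  to (inj₂ (*<* lt)) rewrite eq = ℤₚ.drop‿+<+ (subst₂ ℤ._<_ lhs rhs lt)
  from : a * a < 4 * N → (k / 1) <ᶜ (√ ((+ N) / 1) -ᶜ ((+ 3) / 2))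
  from lt = inj₂ (*<* (subst₂ ℤ._<_ (sym (trans (cong (λ z → z ℤ.* z ℤ.* + 1) eq) lhs)) (sym rhs) (ℤ.+<+ lt)))

-- The numerators for q - 1 and q are 2 q + 1 and 2 q + 3, with squares 4 q (q + 1) + 1 and 4 (q +
-- 1) (q + 2) + 1. In the lower bound integrality absorbs the extra 1.
isCeiling : ∀ N q → q * suc q < N → N ≤ suc q * suc (suc q) →
            IsCeiling (√ ((+ N) / 1) -ᶜ ((+ 3) / 2)) (+ q)
isCeiling N q lower upper =
  Equivalence.from (below-√-3/2 N (+ q ℤ.- + 1) (suc (2 * q)) (predecessor q)) (begin-strict
    suc (2 * q) * suc (2 * q)     ≡⟨ e₁ q ⟩
    4 * (q * suc q) + 1           <⟨ +-monoʳ-< (4 * (q * suc q)) {1} {4} (s≤s (s≤s z≤n)) ⟩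
    4 * (q * suc q) + 4           ≡⟨ e₂ q ⟩
    4 * suc (q * suc q)           ≤⟨ *-monoʳ-≤ 4 lower ⟩
    4 * N ∎) ,
  λ below → <⇒≱ (Equivalence.to (below-√-3/2 N (+ q) (q * 2 + 3) (cong (ℤ._+ + 3) (sym (ℤₚ.pos-* q 2)))) below)
    (begin
    4 * N                               ≤⟨ *-monoʳ-≤ 4 upper ⟩
    4 * (suc q * suc (suc q))           ≤⟨ m≤m+n _ 1 ⟩
    4 * (suc q * suc (suc q)) + 1       ≡⟨ e₃ q ⟩
    (q * 2 + 3) * (q * 2 + 3) ∎)
  where
  open ≤-Reasoning
  e₁ : ∀ q → suc (2 * q) * suc (2 * q) ≡ 4 * (q * suc q) + 1
  e₁ = solve-∀
  e₂ : ∀ q → 4 * (q * suc q) + 4 ≡ 4 * suc (q * suc q)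
  e₂ = solve-∀
  e₃ : ∀ q → 4 * (suc q * suc (suc q)) + 1 ≡ (q * 2 + 3) * (q * 2 + 3)
  e₃ = solve-∀
  e₄ : ∀ q → q * 2 + 3 ≡ suc (2 * suc q)
  e₄ = solve-∀
  predecessor : ∀ q → (+ q ℤ.- + 1) ℤ.* + 2 ℤ.+ + 3 ≡ + suc (2 * q)
  predecessor zero    = refl
  predecessor (suc q) = trans (cong (ℤ._+ + 3) (sym (ℤₚ.pos-* q 2))) (cong +_ (e₄ q))

-- The intervals from q (q + 1), excluded, to (q + 1) (q + 2), included, cover the positive
-- integers; a step of one either stays inside or enters the next.
ceiling-exists : ∀ N → ∃[ q ] (q * suc q < suc N × suc N ≤ suc q * suc (suc q))
ceiling-exists zero = 0 , s≤s z≤n , s≤s z≤n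
ceiling-exists (suc N) with ceiling-exists N
... | q , lower , upper with suc (suc N) ≤? suc q * suc (suc q)
...   | yes p = q , m≤n⇒m≤1+n lower , p
...   | no ¬p = suc q , ≰⇒> ¬p , ≤-trans (s≤s upper)
    -- The next interval has length 2 (q + 2); the slack is this less the one step taken.
    (≤-trans (m≤m+n _ (suc (q + q + 2))) (≤-reflexive (e q)))
  where
  e : ∀ q → suc (suc q * suc (suc q)) + suc (q + q + 2) ≡ suc (suc q) * suc (suc (suc q))
  e = solve-∀

theorem1p3 : ∀ (n : ℕ) → 3 ≤ n →
    ∃[ q ] (IsThresholdBias n q × IsCeiling (√ ((+ (2 * n ∸ 2)) / 1) -ᶜ ((+ 3) / 2)) (+ q))
theorem1p3 (suc zero) (s≤s ())
theorem1p3 (suc (suc k)) 3≤n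
  -- For n = k + 2 the number 2 n - 2 is `suc (2 * k + 1)`; the rewrites bring the truncated
  -- subtraction to this form.
  with q , lower , upper ← ceiling-exists (2 * k + 1)
  rewrite trans (cong (_∸ 2) (*-distribˡ-+ 2 2 k)) (+-comm 2 (2 * k))
        | +-suc (2 * k) 1 =
  q , (breaker , least) , isCeiling _ q lower upper
  where
  breaker : BreakerHasWinningStrategy (2 + k) q
  breaker = _ , Breaker.winning (2 + k) q (≤-trans (≤-reflexive (e k)) (+-monoˡ-≤ 2 upper))
    where
    e : ∀ k → 2 * (2 + k) ≡ suc (2 * k + 1) + 2
    e = solve-∀
  least : ∀ q′ → BreakerHasWinningStrategy (2 + k) q′ → q ≤ q′
  -- A smaller `q′` would give 2 n - 2 ≤ (q′ + 1) (q′ + 2) ≤ q (q + 1), against `lower`.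
  least q′ (σ , W) = ≮⇒≥ λ q′<q → <⇒≱ lower (begin
    suc (2 * k + 1)          ≡⟨ e k ⟩
    2 * suc k                ≤⟨ Maker.bound W ⟩
    suc q′ * suc (suc q′)    ≤⟨ *-mono-≤ q′<q (s≤s q′<q) ⟩
    q * suc q                ∎)
    where
    open ≤-Reasoning
    e : ∀ k → suc (2 * k + 1) ≡ 2 * suc k
    e = solve-∀
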